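{- Let $n\ge 8$ be an integer and define $p(n)=2n-1-\lfloor n/4\rfloor$ if $n\equiv 0$ or $3 \pmod 4$, and $p(n)=2n-\lfloor n/4\rfloor$ otherwise. Then the minimum number of edges of a connected locally nonforesty graph of order $n$ is $p(n)$; that is, every connected locally nonforesty graph of order $n$ has at least $p(n)$ edges, and there exists a connected locally nonforesty graph of order $n$ with exactly $p(n)$ edges.
   Context: All graphs are finite and simple. The order of a graph is its number of vertices and its size is its number of edges. For a vertex $v$ of a graph $G$, the local subgraph at $v$ is the subgraph of $G$ induced by the (open) neighborhood $N(v)$ of $v$. A graph $G$ is called locally nonforesty if every local subgraph of $G$ contains a cycle (equivalently, every vertex of $G$ is the hub of a wheel in $G$). -}

module Defs where

open import Data.Nat using (ℕ; zero; suc; _+_; _*_; _∸_; _≤_; _<ᵇ_)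
open import Data.Nat.DivMod using (_/_; _%_)
open import Data.Bool using (Bool; true; false; _∧_; if_then_else_)
open import Data.Fin using (Fin; toℕ)
open import Data.List using (List; []; _∷_; _++_; [_]; length; allFin; map)
open import Data.Nat.ListAction using (sum)
open import Data.List.Relation.Unary.All using (All)
open import Data.List.Relation.Unary.Linked using (Linked)
open import Data.List.Relation.Unary.Unique.Propositional using (Unique)
open import Data.Product using (Σ; _×_; ∃)
open import Relation.Binary.PropositionalEquality using (_≡_)

record Graph (n : ℕ) : Set where
  field
    adj    : Fin n → Fin n → Bool
    sym    : ∀ i j → adj i j ≡ adj j i
    irrefl : ∀ i → adj i i ≡ false
open Graph public

Adj : ∀ {n} → Graph n → Fin n → Fin n → Set
Adj G i j = adj G i j ≡ true

countTrue : List Bool → ℕ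
countTrue [] = 0
countTrue (true ∷ bs) = suc (countTrue bs)
countTrue (false ∷ bs) = countTrue bs

size : ∀ {n} → Graph n → ℕ
size {n} G = sum (map (λ i → countTrue (map (λ j → (toℕ i <ᵇ toℕ j) ∧ adj G i j) (allFin n))) (allFin n))

data Walk {n : ℕ} (G : Graph n) : Fin n → Fin n → Set where
  here : ∀ {u} → Walk G u u
  step : ∀ {u w v} → Adj G u w → Walk G w v → Walk G u v

Connected : ∀ {n} → Graph n → Set
Connected {n} G = (u v : Fin n) → Walk G u v

record Cycle {n : ℕ} (G : Graph n) : Set where
  field
    start    : Fin n
    rest     : List (Fin n)
    long     : 2 ≤ length rest
    distinct : Unique (start ∷ rest)
    closed   : Linked (Adj G) (start ∷ rest ++ [ start ])
open Cycle public

cycleVertices : ∀ {n} {G : Graph n} → Cycle G → List (Fin n)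
cycleVertices C = start C ∷ rest C

-- the local subgraph at v (induced by N(v)) contains a cycle:
-- a cycle of G all of whose vertices lie in N(v)
LocalSubgraphHasCycle : ∀ {n} → Graph n → Fin n → Set
LocalSubgraphHasCycle G v = Σ (Cycle G) (λ C → All (Adj G v) (cycleVertices C))

LocallyNonforesty : ∀ {n} → Graph n → Set
LocallyNonforesty {n} G = (v : Fin n) → LocalSubgraphHasCycle G v

p : ℕ → ℕ
p n with n % 4
... | 0 = 2 * n ∸ 1 ∸ n / 4
... | 3 = 2 * n ∸ 1 ∸ n / 4
... | _ = 2 * n ∸ n / 4

module Submission where

-- Lower bound.  Grow a vertex set S, keeping the surplus 4 e(S) + 4 - 7 |S| equal to 0 or at
-- least 3.  Take w outside S adjacent to S, and a cycle C in N(w).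
--   * If C meets S, adding w together with an arc of C outside S (or w alone when C lies in S) raises
--     the surplus by at least 3.
--   * If C misses S, add w and all of C, its vertex x last.  This raises the surplus by at least |C| - 3,
--     and by at least |C| + 1 if x then has a fourth neighbour.  Otherwise let D be a cycle in N(x).  Either D
--     leaves the new set, and absorbing an arc of D gives 3 more, or D is the triangle on the three
--     neighbours of x, so that w, x and the two neighbours of x on C form a K₄; adding only this K₄
--     leaves the surplus unchanged or raises it by at least 4.
-- The first step starts from S = ∅ and is the second case with a fictitious edge at w.  At the end 4 m + 4 - 7 n
-- is 0 or at least 3, which rounds to m ≥ p(n).
--
-- Upper bound.  Joining a K₄ by a bridge adds 4 vertices and 7 edges, as p requires, so it suffices to
-- start from K₄, K₅ minus an edge, and two or three copies of K₄ glued in a tree at vertices.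

open import Defs renaming (sym to adj-sym)
open import Data.Bool using (Bool; true; false; _∧_)
import Data.Bool.Properties as Bool
open import Data.Fin using (Fin; zero; suc; toℕ)
import Data.Fin.Properties as Fin
open import Data.List using (List; []; _∷_; _++_; [_]; length; filter; map; tabulate; _ʳ++_; allFin)
open import Data.List.Properties using (++-assoc; length-ʳ++; length-tabulate; length-map; map-++; map-cong; map-tabulate)
open import Data.List.Membership.Propositional using (_∈_; _∉_; find)
open import Data.List.Membership.Propositional.Properties using (∈-∃++; ∈-filter⁺; ∈-allFin)
open import Data.List.Membership.Propositional.Properties.WithK using (unique∧set⇒bag)
open import Data.List.Relation.Binary.BagAndSetEquality using (∼bag⇒↭)
open import Data.List.Relation.Binary.Permutation.Propositional using (_↭_; refl; prep; swap; trans; ↭-sym; ↭⇒↭ₛ)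
open import Data.List.Relation.Binary.Permutation.Propositional.Properties
  using (↭-length; ∈-resp-↭; All-resp-↭; filter-↭; ++-comm; shift)
import Data.List.Relation.Binary.Permutation.Setoid.Properties as Permutationₛ
open import Data.List.Relation.Unary.All as All using (All; []; _∷_; all?)
open import Data.List.Relation.Unary.All.Properties as All using (¬Any⇒All¬; ¬All⇒Any¬)
open import Data.List.Relation.Unary.AllPairs using (AllPairs; []; _∷_)
open import Data.List.Relation.Unary.AllPairs.Properties using (tabulate⁺-<)
open import Data.List.Relation.Unary.Any using (Any; here; there; any?)
open import Data.List.Relation.Unary.Linked using (Linked; []; [-]; _∷_)
import Data.List.Relation.Unary.Linked.Properties as Linked
open import Data.List.Relation.Unary.Unique.Propositional using (Unique)
import Data.List.Relation.Unary.Unique.Propositional.Properties as Unique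
open import Data.Nat
open import Data.Nat.DivMod using (_/_; _%_; m%n<n; m≡m%n+[m/n]*n; /-monoˡ-≤)
open import Data.Nat.ListAction using (sum)
open import Data.Nat.Properties
open import Data.Nat.Tactic.RingSolver using (solve-∀)
open import Data.Product using (Σ; ∃; ∃₂; _×_; _,_; proj₁; proj₂)
open import Data.Sum using (_⊎_; inj₁; inj₂)
open import Function using (_∘_; id; mk⇔)
open import Relation.Binary.PropositionalEquality
  using (_≡_; _≢_; refl; sym; cong; cong₂; subst; subst₂; setoid; module ≡-Reasoning)
  renaming (trans to ≡-trans)
open import Relation.Nullary using (¬_; Dec; yes; no; contradiction)

-- Lists without repetition, reversed appending, linked lists.

module _ {A : Set} where

  unique-⊆⇒length≤ : {xs ys : List A} → Unique xs → All (_∈ ys) xs → length xs ≤ length ys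
  unique-⊆⇒length≤ []           []         = z≤n
  unique-⊆⇒length≤ {x ∷ xs} (x∉ ∷ ux) (x∈ys ∷ xs⊆) with ∈-∃++ x∈ys
  ... | as , bs , refl = begin
    suc (length xs)          ≤⟨ s≤s (unique-⊆⇒length≤ ux (All.zipWith drop-x (x∉ , xs⊆))) ⟩
    suc (length (as ++ bs))  ≡⟨ ↭-length (shift x as bs) ⟨
    length (as ++ x ∷ bs)    ∎
    where
    open ≤-Reasoning
    drop-x : ∀ {y} → x ≢ y × y ∈ as ++ x ∷ bs → y ∈ as ++ bs
    drop-x (x≢y , y∈) with ∈-resp-↭ (shift x as bs) y∈
    ... | here y≡x  = contradiction (sym y≡x) x≢y
    ... | there y∈′ = y∈′

  ∈-ʳ++⁺ʳ : ∀ xs {ys : List A} {v} → v ∈ ys → v ∈ xs ʳ++ ys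
  ∈-ʳ++⁺ʳ []       v∈ = v∈
  ∈-ʳ++⁺ʳ (x ∷ xs) v∈ = ∈-ʳ++⁺ʳ xs (there v∈)

  ∈-ʳ++⁺ˡ : ∀ {xs} {ys : List A} {v} → v ∈ xs → v ∈ xs ʳ++ ys
  ∈-ʳ++⁺ˡ {x ∷ xs} (here refl) = ∈-ʳ++⁺ʳ xs (here refl)
  ∈-ʳ++⁺ˡ {x ∷ xs} (there v∈)  = ∈-ʳ++⁺ˡ v∈

  ∈-ʳ++⁻ : ∀ xs {ys : List A} {v} → v ∈ xs ʳ++ ys → v ∈ xs ⊎ v ∈ ys
  ∈-ʳ++⁻ []       v∈ = inj₂ v∈
  ∈-ʳ++⁻ (x ∷ xs) v∈ with ∈-ʳ++⁻ xs v∈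
  ... | inj₁ v∈xs         = inj₁ (there v∈xs)
  ... | inj₂ (here v≡x)   = inj₁ (here v≡x)
  ... | inj₂ (there v∈ys) = inj₂ v∈ys

  ∉-∷ : ∀ {v x : A} {xs} → v ≢ x → v ∉ xs → v ∉ x ∷ xs
  ∉-∷ v≢x v∉ (here v≡x)  = v≢x v≡x
  ∉-∷ v≢x v∉ (there v∈)  = v∉ v∈

  All-∉-∷ : ∀ {x : A} {xs ys} → All (x ≢_) ys → All (_∉ xs) ys → All (_∉ (x ∷ xs)) ys
  All-∉-∷ x∉ ys∉ = All.zipWith (λ (x≢y , y∉) → ∉-∷ (x≢y ∘ sym) y∉) (x∉ , ys∉)

  ∉⇒All≢ : ∀ {x : A} {xs} → x ∉ xs → All (x ≢_) xs
  ∉⇒All≢ {xs = []}     x∉ = []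
  ∉⇒All≢ {xs = y ∷ xs} x∉ = (x∉ ∘ here) ∷ ∉⇒All≢ (x∉ ∘ there)

  unique-∷ : ∀ {x : A} {xs} → x ∉ xs → Unique xs → Unique (x ∷ xs)
  unique-∷ x∉ u = ∉⇒All≢ x∉ ∷ u

  unique-ʳ++ : ∀ {xs ys : List A} → Unique xs → All (_∉ ys) xs → Unique ys → Unique (xs ʳ++ ys)
  unique-ʳ++ []         []         uy = uy
  unique-ʳ++ (x∉ ∷ ux) (x∉ys ∷ d) uy = unique-ʳ++ ux (All-∉-∷ x∉ d) (unique-∷ x∉ys uy)

  unique-resp-↭ : ∀ {xs ys : List A} → xs ↭ ys → Unique xs → Unique ys
  unique-resp-↭ p = Permutationₛ.Unique-resp-↭ (setoid A) (↭⇒↭ₛ p)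

  module _ {R : A → A → Set} where

    linked-prefix : ∀ xs {a ys} → Linked R (xs ++ a ∷ ys) → Linked R (xs ++ [ a ])
    linked-prefix []           _        = [-]
    linked-prefix (x ∷ [])     (r ∷ _)  = r ∷ [-]
    linked-prefix (x ∷ y ∷ xs) (r ∷ rs) = r ∷ linked-prefix (y ∷ xs) rs

    linked-suffix : ∀ xs {ys} → Linked R (xs ++ ys) → Linked R ys
    linked-suffix []       rs           = rs
    linked-suffix (x ∷ []) {[]} rs      = []
    linked-suffix (x ∷ []) {_ ∷ _} (_ ∷ rs) = rs
    linked-suffix (x ∷ y ∷ xs) (_ ∷ rs) = linked-suffix (y ∷ xs) rs

    linked-join : ∀ xs {a ys} → Linked R (xs ++ [ a ]) → Linked R (a ∷ ys) → Linked R (xs ++ a ∷ ys)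
    linked-join []           _        rs′ = rs′
    linked-join (x ∷ [])     (r ∷ _)  rs′ = r ∷ rs′
    linked-join (x ∷ y ∷ xs) (r ∷ rs) rs′ = r ∷ linked-join (y ∷ xs) rs rs′

    linked-last : ∀ x xs {b} → Linked R (x ∷ xs ++ [ b ]) → ∃ λ y → y ∈ x ∷ xs × R y b
    linked-last x []       (r ∷ _) = x , here refl , r
    linked-last x (y ∷ xs) (_ ∷ rs) with linked-last y xs rs
    ... | z , z∈ , r = z , there z∈ , r

-- Degrees into a vertex list and induced edges.

module _ {n : ℕ} (G : Graph n) where

  V : Set
  V = Fin n

  open import Data.List.Membership.DecPropositional (Fin._≟_ {n}) using (_∈?_)

  Adj-sym : ∀ {u v} → Adj G u v → Adj G v u
  Adj-sym {u} {v} uv = ≡-trans (adj-sym G v u) uv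

  Adj⇒≢ : ∀ {u v} → Adj G u v → u ≢ v
  Adj⇒≢ {u} uv refl with ≡-trans (sym uv) (irrefl G u)
  ... | ()

  nbrs : V → List V → List V
  nbrs v = filter (λ u → adj G v u Bool.≟ true)

  deg : V → List V → ℕ
  deg v S = length (nbrs v S)

  -- Each vertex counts its neighbours among the later entries only, so on a list without repetition
  -- this is the number of induced edges, and adding a vertex in front adds its degree into the old
  -- list.
  edges : List V → ℕ
  edges []      = 0
  edges (v ∷ S) = deg v S + edges S

  deg-≥ : ∀ {v xs S} → Unique xs → All (λ u → u ∈ S × Adj G v u) xs → length xs ≤ deg v S
  deg-≥ u xs⊆ = unique-⊆⇒length≤ u (All.map (λ (u∈ , vu) → ∈-filter⁺ _ u∈ vu) xs⊆)

  deg-≥1 : ∀ {v a S} → a ∈ S → Adj G v a → 1 ≤ deg v S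
  deg-≥1 a∈ va = deg-≥ ([] ∷ []) ((a∈ , va) ∷ [])

  deg-≥2 : ∀ {v a b S} → a ≢ b → a ∈ S → Adj G v a → b ∈ S → Adj G v b → 2 ≤ deg v S
  deg-≥2 a≢b a∈ va b∈ vb = deg-≥ ((a≢b ∷ []) ∷ [] ∷ []) ((a∈ , va) ∷ (b∈ , vb) ∷ [])

  deg-≥3 : ∀ {v a b c S} → a ≢ b → a ≢ c → b ≢ c →
           a ∈ S → Adj G v a → b ∈ S → Adj G v b → c ∈ S → Adj G v c → 3 ≤ deg v S
  deg-≥3 a≢b a≢c b≢c a∈ va b∈ vb c∈ vc =
    deg-≥ ((a≢b ∷ a≢c ∷ []) ∷ (b≢c ∷ []) ∷ [] ∷ []) ((a∈ , va) ∷ (b∈ , vb) ∷ (c∈ , vc) ∷ [])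

  deg-↭ : ∀ {v S T} → S ↭ T → deg v S ≡ deg v T
  deg-↭ p = ↭-length (filter-↭ _ p)

  deg-∷ : ∀ v u S → deg v (u ∷ S) ≡ deg v [ u ] + deg v S
  deg-∷ v u S with adj G v u Bool.≟ true
  ... | yes _ = refl
  ... | no  _ = refl

  deg-sym : ∀ u v → deg u [ v ] ≡ deg v [ u ]
  deg-sym u v rewrite adj-sym G u v with adj G v u Bool.≟ true
  ... | yes _ = refl
  ... | no  _ = refl

  -- Only a swap needs work: an edge between `u` and `v` is charged to whichever comes first, and
  -- adjacency is symmetric.
  edges-↭ : ∀ {S T} → S ↭ T → edges S ≡ edges T
  edges-↭ refl                   = refl
  edges-↭ (prep v p)             = cong₂ _+_ (deg-↭ {v} p) (edges-↭ p)
  edges-↭ (trans p q)            = ≡-trans (edges-↭ p) (edges-↭ q)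
  edges-↭ (swap {S} {T} u v p)   = begin
    deg u (v ∷ S) + (deg v S + edges S)               ≡⟨ cong (_+ _) (deg-∷ u v S) ⟩
    deg u [ v ] + deg u S + (deg v S + edges S)       ≡⟨ interchange (deg u [ v ]) (deg u S) (deg v S) (edges S) ⟩
    deg u [ v ] + deg v S + (deg u S + edges S)       ≡⟨ cong₂ _+_ (cong₂ _+_ (deg-sym u v) (deg-↭ {v} p))
                                                           (cong₂ _+_ (deg-↭ {u} p) (edges-↭ p)) ⟩
    deg v [ u ] + deg v T + (deg u T + edges T)       ≡⟨ cong (_+ _) (deg-∷ v u T) ⟨
    deg v (u ∷ T) + (deg u T + edges T)               ∎
    where
    open ≡-Reasoning
    interchange : ∀ a b c d → a + b + (c + d) ≡ a + c + (b + d)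
    interchange = solve-∀

  -- The size of a graph as an induced edge count.

  upDeg : List V → V → ℕ
  upDeg L i = countTrue (map (λ j → (toℕ i <ᵇ toℕ j) ∧ adj G i j) L)

  upDeg≡deg : ∀ {i L} → All (λ j → toℕ i < toℕ j) L → upDeg L i ≡ deg i L
  upDeg≡deg []                               = refl
  upDeg≡deg {i} {j ∷ L} (i<j ∷ i<) with toℕ i <ᵇ toℕ j | <⇒<ᵇ i<j
  ... | true | _ with adj G i j
  ...   | true  = cong suc (upDeg≡deg i<)
  ...   | false = upDeg≡deg i<

  upDeg-≥ : ∀ {i j} L → toℕ j ≤ toℕ i → upDeg (j ∷ L) i ≡ upDeg L i
  upDeg-≥ {i} {j} L j≤i with toℕ i <ᵇ toℕ j | <ᵇ⇒< (toℕ i) (toℕ j)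
  ... | false | _   = refl
  ... | true  | i<j = contradiction (i<j _) (≤⇒≯ j≤i)

  -- In an ascending list the test on indices selects exactly the later entries, which are those
  -- that `edges` counts.
  ascending-edges : ∀ {L} → AllPairs (λ i j → toℕ i < toℕ j) L → sum (map (upDeg L) L) ≡ edges L
  ascending-edges []                 = refl
  ascending-edges {i ∷ L} (i< ∷ asc) = cong₂ _+_
    (≡-trans (upDeg-≥ {i} L ≤-refl) (upDeg≡deg i<))
    (≡-trans (cong sum (drop-i L i<)) (ascending-edges asc))
    where
    -- As `i` lies below all of `K`, its column adds nothing to their rows.
    drop-i : ∀ K → All (λ j → toℕ i < toℕ j) K → map (upDeg (i ∷ L)) K ≡ map (upDeg L) K
    drop-i []      []          = refl
    drop-i (j ∷ K) (i<j ∷ i<K) = cong₂ _∷_ (upDeg-≥ L (<⇒≤ i<j)) (drop-i K i<K)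

  size≡edges : size G ≡ edges (allFin n)
  size≡edges = ascending-edges (tabulate⁺-< id)

  -- Edges gained by paths in the neighbourhood of a hub.

  -- Every new vertex is adjacent to the hub and to its predecessor. `ʳ++` adds the path front to
  -- back, so the predecessor is always present already.
  path-edges : ∀ {h} a qs {b S} → h ∈ S → a ∈ S → All (Adj G h) (a ∷ qs) →
               Linked (Adj G) (a ∷ qs ++ [ b ]) →
               2 * length qs + edges S ≤ edges (qs ʳ++ S)
  path-edges a []       h∈ a∈ _ _ = ≤-refl
  path-edges {h} a (q ∷ qs) {S = S} h∈ a∈ (ha ∷ hqs@(hq ∷ _)) (aq ∷ l) = begin
    2 * suc (length qs) + edges S       ≡⟨ shuffle (length qs) (edges S) ⟩
    2 * length qs + (2 + edges S)       ≤⟨ +-monoʳ-≤ (2 * length qs) (+-monoˡ-≤ (edges S)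
                                             (deg-≥2 (Adj⇒≢ ha) h∈ (Adj-sym hq) a∈ (Adj-sym aq))) ⟩
    2 * length qs + edges (q ∷ S)       ≤⟨ path-edges q qs (there h∈) (here refl) hqs l ⟩
    edges (qs ʳ++ (q ∷ S))              ∎
    where
    open ≤-Reasoning
    shuffle : ∀ k m → 2 * suc k + m ≡ 2 * k + (2 + m)
    shuffle = solve-∀

  -- The last vertex gains a third edge, to `b`. This edge is new because the predecessor differs
  -- from `b`: it is either `a` with `a ≢ b`, or a vertex of the arc.
  arc-edges : ∀ {h} a q qs {b S} → h ∈ S → a ∈ S → b ∈ S → b ∉ q ∷ qs → All (Adj G h) (a ∷ q ∷ qs) →
              Adj G h b → Linked (Adj G) (a ∷ q ∷ qs ++ [ b ]) → a ≢ b ⊎ 1 ≤ length qs →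
              suc (2 * length (q ∷ qs)) + edges S ≤ edges ((q ∷ qs) ʳ++ S)
  arc-edges a q [] h∈ a∈ b∈ _ (ha ∷ hq ∷ []) hb (aq ∷ qb ∷ [-]) (inj₁ a≢b) =
    +-monoˡ-≤ _ (deg-≥3 (Adj⇒≢ ha) (Adj⇒≢ hb) a≢b h∈ (Adj-sym hq) a∈ (Adj-sym aq) b∈ qb)
  arc-edges {h} a q (r ∷ qs) {b} {S} h∈ a∈ b∈ b∉ (ha ∷ hqs@(hq ∷ _)) hb (aq ∷ l) _ = begin
    suc (2 * suc k) + edges S       ≡⟨ shuffle k (edges S) ⟩
    suc (2 * k) + (2 + edges S)     ≤⟨ +-monoʳ-≤ (suc (2 * k)) (+-monoˡ-≤ (edges S)
                                         (deg-≥2 (Adj⇒≢ ha) h∈ (Adj-sym hq) a∈ (Adj-sym aq))) ⟩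
    suc (2 * k) + edges (q ∷ S)     ≤⟨ arc-edges q r qs (there h∈) (here refl) (there b∈) (b∉ ∘ there)
                                         hqs hb l (inj₁ λ q≡b → b∉ (here (sym q≡b))) ⟩
    edges ((r ∷ qs) ʳ++ (q ∷ S))    ∎
    where
    open ≤-Reasoning
    k = length (r ∷ qs)
    shuffle : ∀ k m → suc (2 * suc k) + m ≡ suc (2 * k) + (2 + m)
    shuffle = solve-∀

  -- Arcs of a cycle outside a vertex set.

  rotate : (C : Cycle G) {a : V} → a ∈ cycleVertices C →
           Σ (Cycle G) λ C′ → start C′ ≡ a × cycleVertices C ↭ cycleVertices C′
  rotate C (here refl) = C , refl , refl
  rotate record { start = s ; rest = rest ; long = long ; distinct = u ; closed = l } {a} (there a∈)
    with xs , ys , refl ← ∈-∃++ a∈ = C′ , refl , perm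
    where
    perm : (s ∷ xs) ++ a ∷ ys ↭ a ∷ ys ++ s ∷ xs
    perm = ++-comm (s ∷ xs) (a ∷ ys)

    l₀ : Linked (Adj G) ((s ∷ xs) ++ a ∷ ys ++ [ s ])
    l₀ = subst (λ zs → Linked (Adj G) (s ∷ zs)) (++-assoc xs (a ∷ ys) [ s ]) l

    C′ : Cycle G
    C′ = record
      { start    = a
      ; rest     = ys ++ s ∷ xs
      ; long     = subst (2 ≤_) (suc-injective (↭-length perm)) long
      ; distinct = unique-resp-↭ perm u
      ; closed   = subst (λ zs → Linked (Adj G) (a ∷ zs)) (sym (++-assoc ys (s ∷ xs) [ a ]))
          (linked-join (a ∷ ys) (linked-suffix (s ∷ xs) l₀) (linked-prefix (s ∷ xs) l₀)) }

  -- The vertices q ∷ qs lie outside S and their neighbours a, b on the path inside it; wide excludes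
  -- a - q - a, where q would gain one edge less.
  record Arc (S : List V) (P : V → Set) : Set where
    field
      {a q b} : V
      {qs}    : List V
      a∈S     : a ∈ S
      b∈S     : b ∈ S
      new     : All (_∉ S) (q ∷ qs)
      unique  : Unique (q ∷ qs)
      linked  : Linked (Adj G) (a ∷ q ∷ qs ++ [ b ])
      inside  : All P (b ∷ a ∷ q ∷ qs)
      wide    : a ≢ b ⊎ 1 ≤ length qs

  -- The part of the path after `q` up to its first return to `S`. `ends` tells a return at `e`
  -- after all of `rest` from an earlier one; the condition `wide` of an arc depends on this.
  record Run (S : List V) (q : V) (rest : List V) (e : V) : Set where
    field
      {b}     : V
      {qs}    : List V
      b∈S     : b ∈ S
      new     : All (_∉ S) qs
      unique  : Unique qs
      linked  : Linked (Adj G) (q ∷ qs ++ [ b ])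
      qs⊆     : All (_∈ rest) qs
      ends    : (qs ≡ rest × b ≡ e) ⊎ b ∈ rest

  run : ∀ S q rest e → e ∈ S → Linked (Adj G) (q ∷ rest ++ [ e ]) → Unique rest → Run S q rest e
  run S q [] e e∈ l u = record
    { b∈S = e∈ ; new = [] ; unique = [] ; linked = l ; qs⊆ = [] ; ends = inj₁ (refl , refl) }
  run S q (r ∷ rest) e e∈ (qr ∷ l) (r∉ ∷ u) with r ∈? S
  ... | yes r∈ = record
    { b∈S = r∈ ; new = [] ; unique = [] ; linked = qr ∷ [-] ; qs⊆ = [] ; ends = inj₂ (here refl) }
  ... | no r∉S = record
    { b∈S = R.b∈S ; new = r∉S ∷ R.new ; unique = All.map (All.lookup r∉) R.qs⊆ ∷ R.unique
    ; linked = qr ∷ R.linked ; qs⊆ = here refl ∷ All.map there R.qs⊆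
    ; ends = ends R.ends }
    where
    module R = Run (run S r rest e e∈ l u)
    ends : (R.qs ≡ rest × R.b ≡ e) ⊎ R.b ∈ rest → (r ∷ R.qs ≡ r ∷ rest × R.b ≡ e) ⊎ R.b ∈ r ∷ rest
    ends (inj₁ (qs≡ , b≡e)) = inj₁ (cong (r ∷_) qs≡ , b≡e)
    ends (inj₂ b∈)            = inj₂ (there b∈)

  -- Vertices of `S` are skipped, `p` being the last one met; the first vertex outside `S` opens the
  -- arc and `run` completes it. The ends can agree only if nothing was skipped and the run goes all
  -- the way round, and then the arc is all of `rest`, with at least two vertices.
  find-arc : ∀ {S P} p rest e → p ∈ S → e ∈ S → Linked (Adj G) (p ∷ rest ++ [ e ]) → Unique (p ∷ rest) →
             e ∉ rest → All P (e ∷ p ∷ rest) → p ≢ e ⊎ 2 ≤ length rest → ¬ All (_∈ S) rest → Arc S P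
  find-arc p [] e p∈ e∈ l u e∉ ps w ¬all = contradiction [] ¬all
  find-arc {S} {P} p (r ∷ rest) e p∈ e∈ (pr ∷ l) (p∉ ∷ u@(r∉ ∷ u′)) e∉ (pe ∷ pp ∷ ps@(pr′ ∷ ps′)) w ¬all
    with r ∈? S
  ... | yes r∈ = find-arc r rest e r∈ e∈ l u (e∉ ∘ there) (pe ∷ ps)
                   (inj₁ λ r≡e → e∉ (here (sym r≡e))) (λ all → ¬all (r∈ ∷ all))
  ... | no r∉S = record
    { a∈S = p∈ ; b∈S = R.b∈S ; new = r∉S ∷ R.new
    ; unique = All.map (All.lookup r∉) R.qs⊆ ∷ R.unique
    ; linked = pr ∷ R.linked
    ; inside = inside-b R.ends ∷ pp ∷ pr′ ∷ All.map (All.lookup ps′) R.qs⊆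
    ; wide = wide w R.ends }
    where
    module R = Run (run S r rest e e∈ l u′)
    inside-b : (R.qs ≡ rest × R.b ≡ e) ⊎ R.b ∈ rest → P R.b
    inside-b (inj₁ (_ , b≡e)) = subst P (sym b≡e) pe
    inside-b (inj₂ b∈rest)      = All.lookup ps′ b∈rest
    wide : p ≢ e ⊎ 2 ≤ length (r ∷ rest) → (R.qs ≡ rest × R.b ≡ e) ⊎ R.b ∈ rest →
           p ≢ R.b ⊎ 1 ≤ length R.qs
    wide (inj₁ p≢e)      (inj₁ (_ , b≡e)) = inj₁ (subst (p ≢_) (sym b≡e) p≢e)
    wide (inj₂ (s≤s 1≤)) (inj₁ (qs≡ , _)) = inj₂ (subst (λ zs → 1 ≤ length zs) (sym qs≡) 1≤)
    wide _               (inj₂ b∈rest)     = inj₁ (All.lookup p∉ (there b∈rest))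

  cycle-arc : ∀ {S P} (C : Cycle G) {a} → All P (cycleVertices C) → a ∈ cycleVertices C → a ∈ S →
              ¬ All (_∈ S) (cycleVertices C) → Arc S P
  cycle-arc C {a} ps a∈C a∈S ¬all with rotate C a∈C
  ... | C′ , refl , p with All-resp-↭ p ps | C′ .distinct
  ...   | pa ∷ ps′ | a∉ ∷ u =
    find-arc a (C′ .rest) a a∈S a∈S (C′ .closed) (a∉ ∷ u) (λ a∈ → All.lookup a∉ a∈ refl) (pa ∷ pa ∷ ps′)
      (inj₂ (C′ .long)) (λ all → ¬all (All-resp-↭ (↭-sym p) (a∈S ∷ all)))

  -- Growth of a vertex set and its surplus.

  -- `t` more vertices and at least `δ` more edges raise the surplus by at least 4 δ - 7 t.
  record Growth (S : List V) (t δ : ℕ) : Set where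
    field
      {S′}    : List V
      unique  : Unique S′
      order   : length S′ ≡ t + length S
      gain    : δ + edges S ≤ edges S′

  arc-growth : ∀ {S h} → Unique S → h ∈ S → (A : Arc S (Adj G h)) →
               let t = length (Arc.q A ∷ Arc.qs A) in Growth S t (suc (2 * t))
  arc-growth u h∈ A = record
    { unique = unique-ʳ++ A.unique A.new u
    ; order  = length-ʳ++ (A.q ∷ A.qs)
    ; gain   = arc-edges A.a A.q A.qs h∈ A.a∈S A.b∈S (λ b∈ → All.lookup A.new b∈ A.b∈S)
                 (All.tail A.inside) (All.head A.inside) A.linked A.wide }
    where module A = Arc A

  -- The gain consists of the edges of the cycle and its spokes from `h`. The vertex `s` enters by
  -- its spoke alone, and the rest is an arc from `s` back to `s`.
  open-cycle-growth : ∀ {S h} (C : Cycle G) → Unique S → h ∈ S → All (Adj G h) (cycleVertices C) →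
                      All (_∉ S) (cycleVertices C) →
                      let j = length (C .rest) in Growth S (suc j) (2 * suc j)
  open-cycle-growth {S} record { start = s ; rest = q ∷ qs ; long = s≤s 1≤ ; distinct = s∉qs ∷ uqs ; closed = l }
                    u h∈ (hs ∷ hqs) (s∉ ∷ qs∉) = record
    { unique = unique-ʳ++ uqs (All-∉-∷ s∉qs qs∉) (unique-∷ s∉ u)
    ; order  = ≡-trans (length-ʳ++ (q ∷ qs)) (+-suc (suc (length qs)) (length S))
    ; gain   = begin
        2 * suc (suc (length qs)) + edges S                          ≡⟨ shuffle (length qs) (edges S) ⟩
        suc (2 * suc (length qs)) + (1 + edges S)                    ≤⟨ +-monoʳ-≤ (suc (2 * suc (length qs)))
                                                                          (+-monoˡ-≤ (edges S) (deg-≥1 h∈ (Adj-sym hs))) ⟩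
        suc (2 * suc (length qs)) + edges (s ∷ S)             ≤⟨ arc-edges s q qs (there h∈) (here refl) (here refl)
                                                                          (λ s∈ → All.lookup s∉qs s∈ refl) (hs ∷ hqs) hs l (inj₂ 1≤) ⟩
        edges ((q ∷ qs) ʳ++ (s ∷ S))                          ∎ }
    where
    open ≤-Reasoning
    shuffle : ∀ k m → 2 * suc (suc k) + m ≡ suc (2 * suc k) + (1 + m)
    shuffle = solve-∀

  -- An arc of t vertices brings 2 t + 1 edges and raises the surplus by t + 4; a cycle disjoint
  -- from `S` brings 2 t edges and raises it by t, where t is at least 3.
  absorb : ∀ {S h} (C : Cycle G) → Unique S → h ∈ S → All (Adj G h) (cycleVertices C) →
           ¬ All (_∈ S) (cycleVertices C) → ∃₂ λ t δ → 3 + 7 * t ≤ 4 * δ × Growth S t δ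
  absorb {S} C u h∈ hC ¬all with any? (_∈? S) (cycleVertices C)
  ... | yes meets with v , v∈C , v∈S ← find meets =
    _ , _ , bound (length (Arc.qs A)) , arc-growth u h∈ A
    where
    A = cycle-arc C hC v∈C v∈S ¬all
    bound : ∀ j → 3 + 7 * suc j ≤ 4 * suc (2 * suc j)
    bound j = subst (3 + 7 * suc j ≤_) (eq j) (m≤m+n _ (2 + j))
      where
      eq : ∀ j → 3 + 7 * suc j + (2 + j) ≡ 4 * suc (2 * suc j)
      eq = solve-∀
  ... | no misses = _ , _ , bound (C .long) , open-cycle-growth C u h∈ hC (¬Any⇒All¬ _ misses)
    where
    bound : ∀ {j} → 2 ≤ j → 3 + 7 * suc j ≤ 4 * (2 * suc j)
    bound {suc (suc j)} (s≤s (s≤s _)) = subst (3 + 7 * (3 + j) ≤_) (eq j) (m≤m+n _ j)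
      where
      eq : ∀ j → 3 + 7 * (3 + j) + j ≡ 4 * (2 * (3 + j))
      eq = solve-∀

  -- Good 4 says that the surplus 4 e(S) + 4 - 7 |S| is 0 or at least 3.  Good 7 is what remains of it
  -- after a new hub has been added to S by a single edge (4 - 7 = -3), and it holds of a one-vertex S.
  Weak Good : ℕ → List V → Set
  Weak k S = 7 * length S ≤ k + 4 * edges S
  Good k S = 7 * length S ≡ k + 4 * edges S ⊎ 3 + 7 * length S ≤ k + 4 * edges S

  good⇒weak : ∀ k S → Good k S → Weak k S
  good⇒weak k S (inj₁ eq) = ≤-reflexive eq
  good⇒weak k S (inj₂ le) = ≤-trans (m≤n+m _ 3) le

  -- The constants `k` before and `k′` after may differ, so that one growth can leave a debt for the
  -- next to repay. In `grow-by`, `c` is the slack won by this growth and `d` the slack that `S`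
  -- already had.
  module Step {S t δ} (g : Growth S t δ) (k k′ : ℕ) where
    open Growth g

    order-eq : ∀ c → c + 7 * length S′ ≡ c + 7 * t + 7 * length S
    order-eq c = ≡-trans (cong (λ l → c + 7 * l) order) (distrib c t (length S))
      where
      distrib : ∀ c t l → c + 7 * (t + l) ≡ c + 7 * t + 7 * l
      distrib = solve-∀

    gain-eq : 4 * δ + k′ + 4 * edges S ≡ k′ + 4 * (δ + edges S)
    gain-eq = distrib δ k′ (edges S)
      where
      distrib : ∀ δ k m → 4 * δ + k + 4 * m ≡ k + 4 * (δ + m)
      distrib = solve-∀

    grow-by : ∀ c d → c + 7 * t + k ≤ 4 * δ + k′ → d + 7 * length S ≤ k + 4 * edges S →
              c + d + 7 * length S′ ≤ k′ + 4 * edges S′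
    grow-by c d le w = begin
      c + d + 7 * length S′                ≡⟨ order-eq (c + d) ⟩
      c + d + 7 * t + 7 * length S         ≡⟨ regroup c d (7 * t) _ ⟩
      c + 7 * t + (d + 7 * length S)       ≤⟨ +-monoʳ-≤ (c + 7 * t) w ⟩
      c + 7 * t + (k + 4 * edges S)        ≡⟨ +-assoc (c + 7 * t) k _ ⟨
      c + 7 * t + k + 4 * edges S          ≤⟨ +-monoˡ-≤ (4 * edges S) le ⟩
      4 * δ + k′ + 4 * edges S             ≡⟨ gain-eq ⟩
      k′ + 4 * (δ + edges S)               ≤⟨ +-monoʳ-≤ k′ (*-monoʳ-≤ 4 gain) ⟩
      k′ + 4 * edges S′                    ∎
      where
      open ≤-Reasoning
      regroup : ∀ c d x y → c + d + x + y ≡ c + x + (d + y)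
      regroup = solve-∀

    weak : 7 * t + k ≤ 4 * δ + k′ → Weak k S → Weak k′ S′
    weak = grow-by 0 0

    strict : 3 + 7 * t + k ≤ 4 * δ + k′ → Weak k S → Good k′ S′
    strict le w = inj₂ (grow-by 3 0 le w)

    exact : 7 * t + k ≡ 4 * δ + k′ → δ + edges S ≡ edges S′ → 7 * length S ≡ k + 4 * edges S →
            7 * length S′ ≡ k′ + 4 * edges S′
    exact eq edges-eq e = begin
      7 * length S′                    ≡⟨ order-eq 0 ⟩
      7 * t + 7 * length S             ≡⟨ cong (7 * t +_) e ⟩
      7 * t + (k + 4 * edges S)        ≡⟨ +-assoc (7 * t) k _ ⟨
      7 * t + k + 4 * edges S          ≡⟨ cong (_+ 4 * edges S) eq ⟩
      4 * δ + k′ + 4 * edges S         ≡⟨ gain-eq ⟩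
      k′ + 4 * (δ + edges S)           ≡⟨ cong (λ m → k′ + 4 * m) edges-eq ⟩
      k′ + 4 * edges S′                ∎
      where open ≡-Reasoning

  -- The surplus changes by multiples of 4 once |S| is fixed, so an exact balance cannot become 1 or 2.
  tight-step : ∀ {S t δ} (g : Growth S t δ) k k′ → 7 * t + k ≡ 4 * δ + k′ → Good k S → Good k′ (Growth.S′ g)
  tight-step g k k′ eq (inj₂ le) = inj₂ (Step.grow-by g k k′ 0 3 (≤-reflexive eq) le)
  tight-step {S} {t} {δ} g k k′ eq (inj₁ e) with m≤n⇒m<n∨m≡n (Growth.gain g)
  ... | inj₂ edges-eq = inj₁ (Step.exact g k k′ eq edges-eq e)
  ... | inj₁ more     =
    Step.strict {S} {t} {suc δ} (record { unique = unique ; order = order ; gain = more }) k k′ bound (≤-reflexive e)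
    where
    open Growth g
    open ≤-Reasoning
    bound : 3 + 7 * t + k ≤ 4 * suc δ + k′
    bound = begin
      3 + (7 * t + k)     ≡⟨ cong (3 +_) eq ⟩
      3 + (4 * δ + k′)    ≤⟨ n≤1+n _ ⟩
      4 + (4 * δ + k′)    ≡⟨ cong (_+ k′) (*-suc 4 δ) ⟨
      4 * suc δ + k′      ∎

  -- Vertices of degree three and K₄.

  triangle-adjacent : (D : Cycle G) → length (cycleVertices D) ≤ 3 →
                      ∀ {y z} → y ∈ cycleVertices D → z ∈ cycleVertices D → y ≢ z → Adj G y z
  triangle-adjacent record { rest = _ ∷ [] ; long = s≤s () }
  triangle-adjacent record { rest = _ ∷ _ ∷ _ ∷ _ } (s≤s (s≤s (s≤s ())))
  triangle-adjacent record { rest = _ ∷ _ ∷ [] ; closed = ab ∷ bc ∷ ca ∷ [-] } _ = adjacent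
    where
    adjacent : ∀ {y z} → y ∈ _ → z ∈ _ → y ≢ z → Adj G y z
    adjacent (here refl)                 (here refl)                 y≢z = contradiction refl y≢z
    adjacent (here refl)                 (there (here refl))         _   = ab
    adjacent (here refl)                 (there (there (here refl))) _   = Adj-sym ca
    adjacent (there (here refl))         (here refl)                 _   = Adj-sym ab
    adjacent (there (here refl))         (there (here refl))         y≢z = contradiction refl y≢z
    adjacent (there (here refl))         (there (there (here refl))) _   = bc
    adjacent (there (there (here refl))) (here refl)                 _   = ca
    adjacent (there (there (here refl))) (there (here refl))         _   = Adj-sym bc
    adjacent (there (there (here refl))) (there (there (here refl))) y≢z = contradiction refl y≢z

  -- `D` has at least three vertices, all among the at most three neighbours of `x` in `S`. Hence it
  -- is a triangle through all of these neighbours.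
  saturated : ∀ {x S} (D : Cycle G) → All (Adj G x) (cycleVertices D) → All (_∈ S) (cycleVertices D) →
              deg x S ≤ 3 → ∀ {y z} → y ∈ S → Adj G x y → z ∈ S → Adj G x z → y ≢ z → Adj G y z
  saturated {x} {S} D xD D⊆ deg≤3 y∈ xy z∈ xz =
    triangle-adjacent D (≤-trans (unique-⊆⇒length≤ (D .distinct) D⊆nbrs) deg≤3) (in-cycle y∈ xy) (in-cycle z∈ xz)
    where
    D⊆nbrs : All (_∈ nbrs x S) (cycleVertices D)
    D⊆nbrs = All.zipWith (λ (u∈ , xu) → ∈-filter⁺ _ u∈ xu) (D⊆ , xD)
    in-cycle : ∀ {v} → v ∈ S → Adj G x v → v ∈ cycleVertices D
    in-cycle {v} v∈ xv with v ∈? cycleVertices D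
    ... | yes v∈D = v∈D
    ... | no  v∉D = contradiction
      (≤-trans (unique-⊆⇒length≤ (unique-∷ v∉D (D .distinct)) (∈-filter⁺ _ v∈ xv ∷ D⊆nbrs)) deg≤3)
      (<⇒≱ (s≤s (s≤s (D .long))))

  add-vertex : ∀ {S v d} → Unique S → v ∉ S → d ≤ deg v S → Growth S 1 d
  add-vertex {S} {v} u v∉ d≤ = record
    { S′ = v ∷ S ; unique = unique-∷ v∉ u ; order = refl ; gain = +-monoˡ-≤ (edges S) d≤ }

  growth-< : ∀ {S t δ} (g : Growth S (suc t) δ) → length S < length (Growth.S′ g)
  growth-< {S} {t} g = subst (length S <_) (sym (Growth.order g)) (s≤s (m≤n+m (length S) t))

  Larger : List V → Set
  Larger S = Σ (List V) λ S′ → Unique S′ × length S < length S′ × Good 4 S′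

  -- `z`, `y`, `x` enter in this order with 1, 2, 3 edges. With one edge for the hub, four vertices
  -- cost seven edges, the rate that leaves the surplus unchanged.
  add-K₄ : ∀ {S w x y z} → Unique S → w ∈ S → x ∉ S → y ∉ S → z ∉ S → x ≢ y → x ≢ z →
           Adj G w x → Adj G w y → Adj G w z → Adj G x y → Adj G x z → Adj G y z → Growth S 3 6
  add-K₄ {S} {w} {x} {y} {z} u w∈ x∉ y∉ z∉ x≢y x≢z wx wy wz xy xz yz = record
    { S′     = x ∷ y ∷ z ∷ S
    ; unique = unique-∷ (∉-∷ x≢y (∉-∷ x≢z x∉)) (unique-∷ (∉-∷ (Adj⇒≢ yz) y∉) (unique-∷ z∉ u))
    ; order  = refl
    ; gain   = +-mono-≤ {3} {deg x (y ∷ z ∷ S)} {3 + edges S}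
        (deg-≥3 (Adj⇒≢ yz) (Adj⇒≢ wy ∘ sym) (Adj⇒≢ wz ∘ sym) (here refl) xy (there (here refl)) xz
                (there (there w∈)) (Adj-sym wx))
        (+-mono-≤ {2} {deg y (z ∷ S)} {1 + edges S}
          (deg-≥2 (Adj⇒≢ wz ∘ sym) (here refl) yz (there w∈) (Adj-sym wy))
          (+-monoˡ-≤ (edges S) (deg-≥1 w∈ (Adj-sym wz)))) }

  -- Lower bound: growth up to a spanning set.

  module _ (wheels : LocallyNonforesty G) where

    -- `Good 7` carries the debt of a hub `w` attached by one edge. All of `C` but `x` is added
    -- first; the degree of `x` into the result decides how to go on.
    wheel-step : ∀ {S w} → Unique S → w ∈ S → Good 7 S → (C : Cycle G) → All (Adj G w) (cycleVertices C) →
                 All (_∉ S) (cycleVertices C) → Larger S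
    wheel-step u w∈ good record { rest = _ ∷ [] ; long = s≤s () }
    wheel-step {S} {w} u w∈ good
      record { start = x ; rest = z ∷ q ∷ qs ; distinct = x≢@(x≢z ∷ x≢qs) ∷ z≢ ∷ uqs ; closed = xz ∷ l@(_ ∷ l′) }
      (wx ∷ hC@(wz ∷ wqs)) (x∉ ∷ z∉ ∷ qs∉) with linked-last q qs l′
    -- `y` and `z` are the two neighbours of `x` on the cycle.
    ... | y , y∈qs , yx = result (4 ≤? deg x S₃) (all? (_∈? S₄) (cycleVertices D))
      where
      S₃ S₄ : List V
      S₃ = (q ∷ qs) ʳ++ (z ∷ S)
      S₄ = x ∷ S₃

      D : Cycle G
      D = proj₁ (wheels x)
      xD : All (Adj G x) (cycleVertices D)
      xD = proj₂ (wheels x)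

      x∉S₃ : x ∉ S₃
      x∉S₃ x∈ with ∈-ʳ++⁻ (q ∷ qs) x∈
      ... | inj₁ x∈qs          = All.lookup x≢qs x∈qs refl
      ... | inj₂ (here x≡z)    = x≢z x≡z
      ... | inj₂ (there x∈S)   = x∉ x∈S

      y∈S₃ : y ∈ S₃
      y∈S₃ = ∈-ʳ++⁺ˡ y∈qs
      z∈S₃ : z ∈ S₃
      z∈S₃ = ∈-ʳ++⁺ʳ (q ∷ qs) (here refl)
      y≢z : y ≢ z
      y≢z refl = All.lookup z≢ y∈qs refl

      3≤deg : 3 ≤ deg x S₃
      3≤deg = deg-≥3 y≢z (Adj⇒≢ (All.lookup wqs y∈qs) ∘ sym) (Adj⇒≢ wz ∘ sym)
        y∈S₃ (Adj-sym yx) z∈S₃ xz (∈-ʳ++⁺ʳ (q ∷ qs) (there w∈)) (Adj-sym wx)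

      i : ℕ
      i = length qs

      path : Growth S (2 + i) (1 + 2 * suc i)
      path = record
        { S′     = S₃
        ; unique = unique-ʳ++ uqs (All-∉-∷ z≢ qs∉) (unique-∷ z∉ u)
        ; order  = ≡-trans (length-ʳ++ (q ∷ qs)) (+-suc (suc i) (length S))
        ; gain   = begin
            1 + 2 * suc i + edges S          ≡⟨ +-suc (2 * suc i) (edges S) ⟨
            2 * suc i + (1 + edges S)        ≤⟨ +-monoʳ-≤ (2 * suc i) (+-monoˡ-≤ (edges S) (deg-≥1 w∈ (Adj-sym wz))) ⟩
            2 * suc i + edges (z ∷ S)        ≤⟨ path-edges z (q ∷ qs) (there w∈) (here refl) hC l ⟩
            edges S₃                         ∎ }
        where open ≤-Reasoning

      -- The path changes the surplus by 4 (3 + 2 i) - 7 (2 + i) = i - 2, hence the constant rises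
      -- from 7 to 9.
      weak₃ : Weak 9 S₃
      weak₃ = Step.weak path 7 9 (subst (7 * (2 + i) + 7 ≤_) (eq i) (m≤m+n _ i)) (good⇒weak 7 S good)
        where
        eq : ∀ i → 7 * (2 + i) + 7 + i ≡ 4 * (1 + 2 * suc i) + 9
        eq = solve-∀

      close : Growth S₃ 1 3
      close = add-vertex (Growth.unique path) x∉S₃ 3≤deg

      S<S₃ : length S < length S₃
      S<S₃ = growth-< path

      result : Dec (4 ≤ deg x S₃) → Dec (All (_∈ S₄) (cycleVertices D)) → Larger S
      result (yes 4≤deg) _ =
        S₄ , Growth.unique close₄ , <-trans S<S₃ (growth-< close₄) , Step.strict close₄ 9 4 (n≤1+n 19) weak₃
        where
        close₄ : Growth S₃ 1 4
        close₄ = add-vertex (Growth.unique path) x∉S₃ 4≤deg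
      -- `S₄` might have surplus 1 or 2, so the growth restarts from `S` with the K₄ alone.
      result (no deg≱4) (yes D⊆S₄) =
        Growth.S′ K₄ , Growth.unique K₄ , growth-< K₄ , tight-step K₄ 7 4 refl good
        where
        D⊆S₃ : All (_∈ S₃) (cycleVertices D)
        D⊆S₃ = All.zipWith drop-x (D⊆S₄ , xD)
          where
          drop-x : ∀ {v} → v ∈ S₄ × Adj G x v → v ∈ S₃
          drop-x (here v≡x , xv) = contradiction (sym v≡x) (Adj⇒≢ xv)
          drop-x (there v∈ , _)  = v∈
        K₄ : Growth S 3 6
        K₄ = add-K₄ u w∈ x∉ (All.lookup qs∉ y∈qs) z∉ (Adj⇒≢ yx ∘ sym) x≢z
          wx (All.lookup wqs y∈qs) wz (Adj-sym yx) xz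
          (saturated D xD D⊆S₃ (≤-pred (≰⇒> deg≱4)) y∈S₃ (Adj-sym yx) z∈S₃ xz y≢z)
      -- The surplus of `S₄` is only known to be nonnegative; `absorb` supplies the missing 3.
      result (no _) (no D⊈S₄) with absorb D (Growth.unique close) (here refl) xD D⊈S₄
      ... | t , δ , le , g = Growth.S′ g , Growth.unique g , <-≤-trans (<-trans S<S₃ (growth-< close)) S₄≤ ,
        Step.strict g 4 4 (+-monoˡ-≤ 4 le) (Step.weak close 9 4 ≤-refl weak₃)
        where
        S₄≤ : length S₄ ≤ length (Growth.S′ g)
        S₄≤ = subst (length S₄ ≤_) (sym (Growth.order g)) (m≤n+m _ t)

    frontier-step : ∀ {S u w} → Unique S → u ∈ S → w ∉ S → Adj G w u → Good 4 S → Larger S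
    frontier-step {S} {u} {w} uS u∈ w∉ wu good = result (all? (_∈? S) vs) (any? (_∈? S) vs)
      where
      C : Cycle G
      C = proj₁ (wheels w)
      wC : All (Adj G w) (cycleVertices C)
      wC = proj₂ (wheels w)
      vs : List V
      vs = cycleVertices C

      old : ∀ {v} → v ∈ w ∷ S → Adj G w v → v ∈ S
      old (here v≡w) wv = contradiction (sym v≡w) (Adj⇒≢ wv)
      old (there v∈) _  = v∈

      hub : ∀ {d} → d ≤ deg w S → Growth S 1 d
      hub = add-vertex uS w∉
      uwS : Unique (w ∷ S)
      uwS = unique-∷ w∉ uS

      result : Dec (All (_∈ S) vs) → Dec (Any (_∈ S) vs) → Larger S
      -- The cycle gives `w` three neighbours in `S`, and 4 · 3 - 7 = 5.
      result (yes vs⊆S) _ = w ∷ S , uwS , ≤-refl , Step.strict g 4 4 (m≤m+n 14 2) (good⇒weak 4 S good)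
        where
        g : Growth S 1 3
        g = hub (≤-trans (s≤s (C .long)) (deg-≥ (C .distinct) (All.zip (vs⊆S , wC))))
      result (no vs⊈S) (yes meets) = grown A.wide
        where
        -- `w` is not its own neighbour, so the ends of this arc lie in `S` itself.
        A : Arc (w ∷ S) (Adj G w)
        A with v , v∈C , v∈S ← find meets =
          cycle-arc C wC v∈C (there v∈S) (λ vs⊆ → vs⊈S (All.zipWith (λ (v∈ , wv) → old v∈ wv) (vs⊆ , wC)))
        module A = Arc A
        i : ℕ
        i = length A.qs
        g : Growth (w ∷ S) (suc i) (suc (2 * suc i))
        g = arc-growth uwS (here refl) A
        grown : A.a ≢ A.b ⊎ 1 ≤ i → Larger S
        grown w = Growth.S′ g , Growth.unique g , <-trans ≤-refl (growth-< g) , gained w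
          where
          gained : A.a ≢ A.b ⊎ 1 ≤ i → Good 4 (Growth.S′ g)
          -- Distinct ends are two neighbours of `w` in `S`, so `w` enters with a gain of 1.
          gained (inj₁ a≢b) = Step.strict g 3 4 (subst (3 + 7 * suc i + 3 ≤_) (eq i) (m≤m+n _ (3 + i)))
              (Step.weak (hub 2≤deg) 4 3 ≤-refl (good⇒weak 4 S good))
            where
            2≤deg : 2 ≤ deg _ S
            2≤deg with wb ∷ wa ∷ _ ← A.inside = deg-≥2 a≢b (old A.a∈S wa) wa (old A.b∈S wb) wb
            eq : ∀ i → 3 + 7 * suc i + 3 + (3 + i) ≡ 4 * suc (2 * suc i) + 4
            eq = solve-∀
          -- Here `w` counts one edge only, a loss of 3; the arc has at least two vertices and
          -- returns at least 6.
          gained (inj₂ 1≤i) = Step.strict g 7 4 (bound 1≤i)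
              (Step.weak (hub (deg-≥1 u∈ wu)) 4 7 ≤-refl (good⇒weak 4 S good))
            where
            bound : ∀ {i} → 1 ≤ i → 3 + 7 * suc i + 7 ≤ 4 * suc (2 * suc i) + 4
            bound {suc i} _ = subst (3 + 7 * (2 + i) + 7 ≤_) (eq i) (m≤m+n _ i)
              where
              eq : ∀ i → 3 + 7 * (2 + i) + 7 + i ≡ 4 * suc (2 * (2 + i)) + 4
              eq = solve-∀
      result (no _) (no misses)
        with wheel-step uwS (here refl) (tight-step (hub (deg-≥1 u∈ wu)) 4 7 refl good) C wC
               (All.zipWith (λ (v∉ , wv) → ∉-∷ (Adj⇒≢ wv ∘ sym) v∉) (¬Any⇒All¬ _ misses , wC))
      ... | S′ , u′ , lt , good′ = S′ , u′ , <-trans ≤-refl lt , good′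

    -- `k` bounds the number of vertices still missing and decreases with each enlargement. By
    -- connectedness some walk leaves `S`, and its first edge out of `S` feeds `frontier-step`.
    spanning : ∀ k S → 0 < length S → Unique S → Good 4 S → n ≤ k + length S → Connected G →
               Σ (List V) λ T → Unique T × (∀ v → v ∈ T) × Good 4 T
    spanning k S@(u ∷ _) _ uS good n≤ conn with all? (_∈? S) (allFin n)
    ... | yes all = S , uS , (λ v → All.lookup all (∈-allFin v)) , good
    ... | no ¬all = continue k n≤
      where
      escape : ∀ {x v} → Walk G x v → x ∈ S → v ∉ S → ∃₂ λ a b → a ∈ S × b ∉ S × Adj G b a
      escape here x∈ v∉ = contradiction x∈ v∉
      escape (step {w = y} xy walk) x∈ v∉ with y ∈? S
      ... | yes y∈ = escape walk y∈ v∉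
      ... | no  y∉ = _ , _ , x∈ , y∉ , Adj-sym xy

      larger : Larger S
      larger with v , _ , v∉ ← find (¬All⇒Any¬ (_∈? S) _ ¬all)
             with _ , _ , a∈ , b∉ , ba ← escape (conn u v) (here refl) v∉ = frontier-step uS a∈ b∉ ba good

      continue : ∀ k → n ≤ k + length S → Σ (List V) λ T → Unique T × (∀ v → v ∈ T) × Good 4 T
      continue k n≤ with larger
      continue zero    n≤ | S′ , uS′ , S<S′ , _ = contradiction (≤-trans S′≤n n≤) (<⇒≱ S<S′)
        where
        S′≤n : length S′ ≤ n
        S′≤n = subst (length S′ ≤_) (length-tabulate id) (unique-⊆⇒length≤ uS′ (All.universal ∈-allFin S′))
      continue (suc k) n≤ | S′ , uS′ , S<S′ , good′ =
        spanning k S′ (<-≤-trans z<s S<S′) uS′ good′ (≤-trans n≤ (subst (_≤ k + length S′) (+-suc k _) (+-monoʳ-≤ k S<S′))) conn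

    good-size : V → Connected G → 7 * n ≡ 4 + 4 * size G ⊎ 3 + 7 * n ≤ 4 + 4 * size G
    good-size v conn
      with S , uS , lt , good ← wheel-step ([] ∷ []) (here refl) (inj₁ refl) (proj₁ (wheels v)) (proj₂ (wheels v))
             (All.map (λ vw → ∉-∷ (Adj⇒≢ vw ∘ sym) λ ()) (proj₂ (wheels v)))
      with T , uT , T-all , good′ ← spanning n S (<-trans z<s lt) uS good (m≤m+n n _) conn
      -- Two lists without repetition and with the same members are permutations of each other, so
      -- `edges T` is the size of `G`.
      with T↭ ← ∼bag⇒↭ (unique∧set⇒bag uT (Unique.allFin⁺ n) (mk⇔ (λ _ → ∈-allFin _) (λ _ → T-all _)))
      rewrite size≡edges | sym (edges-↭ T↭) =
      subst (λ l → 7 * l ≡ 4 + 4 * edges T ⊎ 3 + 7 * l ≤ 4 + 4 * edges T)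
        {y = n} (≡-trans (↭-length T↭) (length-tabulate {n = n} id)) good′

-- Upper bound: extremal graphs built by adding vertices.

extend : ∀ {n} → Graph n → (Fin n → Bool) → Graph (suc n)
extend {n} G N = record { adj = adj′ ; sym = sym′ ; irrefl = irrefl′ }
  where
  adj′ : Fin (suc n) → Fin (suc n) → Bool
  adj′ zero    zero    = false
  adj′ zero    (suc j) = N j
  adj′ (suc i) zero    = N i
  adj′ (suc i) (suc j) = adj G i j
  sym′ : ∀ i j → adj′ i j ≡ adj′ j i
  sym′ zero    zero    = refl
  sym′ zero    (suc j) = refl
  sym′ (suc i) zero    = refl
  sym′ (suc i) (suc j) = adj-sym G i j
  irrefl′ : ∀ i → adj′ i i ≡ false
  irrefl′ zero    = refl
  irrefl′ (suc i) = irrefl G i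

map-tabulate-suc : ∀ {A : Set} {n} (f : Fin (suc n) → A) → map f (tabulate suc) ≡ map (f ∘ suc) (allFin n)
map-tabulate-suc f = ≡-trans (map-tabulate suc f) (sym (map-tabulate id (f ∘ suc)))

-- The new vertex has the least index: its row counts all its edges, and its column is false in
-- every other row.
size-extend : ∀ {n} (G : Graph n) N → size (extend G N) ≡ countTrue (map N (allFin n)) + size G
size-extend {n} G N = cong₂ _+_ (cong countTrue (map-tabulate-suc (entry zero)))
  (cong sum (≡-trans (map-tabulate-suc row)
    (map-cong (λ i → cong countTrue (map-tabulate-suc (entry (suc i)))) (allFin n))))
  where
  entry : Fin (suc n) → Fin (suc n) → Bool
  entry i j = (toℕ i <ᵇ toℕ j) ∧ adj (extend G N) i j
  row : Fin (suc n) → ℕ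
  row i = countTrue (map (entry i) (allFin (suc n)))

module _ {n} {G : Graph n} {N : Fin n → Bool} where

  lift-walk : ∀ {u v} → Walk G u v → Walk (extend G N) (suc u) (suc v)
  lift-walk here          = here
  lift-walk (step uw w⇝v) = step uw (lift-walk w⇝v)

  _⇝⇝_ : ∀ {u v w} → Walk (extend G N) u v → Walk (extend G N) v w → Walk (extend G N) u w
  here         ⇝⇝ q = q
  (step uw p)  ⇝⇝ q = step uw (p ⇝⇝ q)

  extend-connected : ∀ u → N u ≡ true → Connected G → Connected (extend G N)
  extend-connected u Nu conn zero    zero    = here
  extend-connected u Nu conn zero    (suc j) = step Nu (lift-walk (conn u j))
  extend-connected u Nu conn (suc i) zero    = lift-walk (conn i u) ⇝⇝ step Nu here
  extend-connected u Nu conn (suc i) (suc j) = lift-walk (conn i j)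

  lift-cycle : ∀ {v} → LocalSubgraphHasCycle G v → LocalSubgraphHasCycle (extend G N) (suc v)
  lift-cycle (C , vC) = record
    { start    = suc (C .start)
    ; rest     = map suc (C .rest)
    ; long     = subst (2 ≤_) (sym (length-map suc (C .rest))) (C .long)
    ; distinct = Unique.map⁺ Fin.suc-injective (C .distinct)
    ; closed   = subst (λ vs → Linked (Adj (extend G N)) (suc (C .start) ∷ vs)) (map-++ suc (C .rest) _)
                   (Linked.map⁺ (C .closed)) }
    , All.map⁺ vC

triangle : ∀ {n} {G : Graph n} v a b c → Adj G v a → Adj G v b → Adj G v c →
           Adj G a b → Adj G b c → Adj G c a → LocalSubgraphHasCycle G v
triangle {G = G} v a b c va vb vc ab bc ca = record
  { start = a ; rest = b ∷ c ∷ [] ; long = s≤s (s≤s z≤n)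
  ; distinct = (≢ ab ∷ (≢ ca ∘ sym) ∷ []) ∷ (≢ bc ∷ []) ∷ [] ∷ []
  ; closed = ab ∷ bc ∷ ca ∷ [-] } , va ∷ vb ∷ vc ∷ []
  where
  ≢ : ∀ {i j} → Adj G i j → i ≢ j
  ≢ = Adj⇒≢ G

-- New vertices take index 0, so the first `k` vertices are the latest ones; cones with 1, 2, 3 in
-- succession build a K₄ on the old vertex 0.
cone : ∀ {n} → Graph n → ℕ → Graph (suc n)
cone G k = extend G (λ i → toℕ i <ᵇ k)

size-cone : ∀ {n} (G : Graph n) {k} → k ≤ n → size (cone G k) ≡ k + size G
size-cone {n} G {k} k≤n = ≡-trans (size-extend G _)
  (cong (_+ size G) (≡-trans (cong countTrue (map-tabulate {n = n} id (λ i → toℕ i <ᵇ k))) (count n k≤n)))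
  where
  count : ∀ n {k} → k ≤ n → countTrue (tabulate {n = n} (λ i → toℕ i <ᵇ k)) ≡ k
  count zero    z≤n       = refl
  count (suc n) z≤n       = count n z≤n
  count (suc n) (s≤s k≤n) = cong suc (count n k≤n)

cone-connected : ∀ {n} {G : Graph (suc n)} k → Connected G → Connected (cone G (suc k))
cone-connected k = extend-connected zero refl

-- K₄ glued to G at the vertex 0 of G.
glue : ∀ {n} → Graph (suc n) → Graph (4 + n)
glue G = cone (cone (cone G 1) 2) 3

-- Vertex 0 of `G` finds its wheel in the new K₄ and may lack one in `G`, as in `point` or at a
-- pendant vertex.
glue-local : ∀ {n} {G : Graph (suc n)} → (∀ v → LocalSubgraphHasCycle G (suc v)) → LocallyNonforesty (glue G)
glue-local loc zero                      = triangle zero (suc zero) (suc (suc zero)) (suc (suc (suc zero))) refl refl refl refl refl refl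
glue-local loc (suc zero)                = triangle (suc zero) zero (suc (suc zero)) (suc (suc (suc zero))) refl refl refl refl refl refl
glue-local loc (suc (suc zero))          = triangle (suc (suc zero)) zero (suc zero) (suc (suc (suc zero))) refl refl refl refl refl refl
glue-local loc (suc (suc (suc zero)))    = triangle (suc (suc (suc zero))) zero (suc zero) (suc (suc zero)) refl refl refl refl refl refl
glue-local loc (suc (suc (suc (suc v)))) = lift-cycle (lift-cycle (lift-cycle (loc v)))

glue-connected : ∀ {n} {G : Graph (suc n)} → Connected G → Connected (glue G)
glue-connected = cone-connected 2 ∘ cone-connected 1 ∘ cone-connected 0

size-glue : ∀ {n} (G : Graph (suc n)) → size (glue G) ≡ 6 + size G
size-glue G = ≡-trans (size-cone (cone (cone G 1) 2) (s≤s (s≤s (s≤s z≤n))))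
  (cong (3 +_) (≡-trans (size-cone (cone G 1) (s≤s (s≤s z≤n))) (cong (2 +_) (size-cone G (s≤s z≤n)))))

Attained : ℕ → ℕ → Set
Attained n m = Σ (Graph n) λ G → Connected G × LocallyNonforesty G × size G ≡ m

attained-glue : ∀ {n m} → Attained (suc n) m → Attained (4 + n) (6 + m)
attained-glue (G , conn , loc , size≡) =
  glue G , glue-connected conn , glue-local (loc ∘ suc) , ≡-trans (size-glue G) (cong (6 +_) size≡)

-- The pendant vertex of `cone G 1` becomes a corner of the new K₄, and its edge to `G` the bridge.
attained-bridge : ∀ {n m} → Attained (suc n) m → Attained (5 + n) (7 + m)
attained-bridge (G , conn , loc , size≡) =
  glue (cone G 1) , glue-connected (cone-connected 0 conn) , glue-local (lift-cycle ∘ loc) ,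
  ≡-trans (size-glue (cone G 1)) (cong (6 +_) (≡-trans (size-cone G (s≤s z≤n)) (cong suc size≡)))

attained-bridges : ∀ {n m} → Attained (suc n) m → ∀ q → Attained (suc n + q * 4) (m + q * 7)
attained-bridges {n} {m} att zero    = subst₂ Attained (sym (+-identityʳ (suc n))) (sym (+-identityʳ m)) att
attained-bridges {n} {m} att (suc q) =
  subst₂ Attained (exchange 4 (suc n) (q * 4)) (exchange 7 m (q * 7)) (attained-bridge (attained-bridges att q))
  where
  exchange : ∀ a b c → a + (b + c) ≡ b + (a + c)
  exchange = solve-∀

point : Graph 1
point = record { adj = λ _ _ → false ; sym = λ _ _ → refl ; irrefl = λ _ → refl }

attained-4 : Attained 4 6
attained-4 = glue point , glue-connected (λ { zero zero → here ; zero (suc ()) ; (suc ()) _ }) , glue-local (λ ()) , refl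

attained-5 : Attained 5 9
attained-5 = let _ , conn , loc , _ = attained-4 in cone (glue point) 3 , cone-connected 2 conn ,
  (λ { zero    → triangle zero (suc zero) (suc (suc zero)) (suc (suc (suc zero))) refl refl refl refl refl refl
     ; (suc v) → lift-cycle (loc v) }) , refl

-- Residues modulo 4 and the value of `p`.

quarter : ∀ c x y → suc c + 4 * x ≤ 4 * y → x < y
quarter c x y le = *-cancelˡ-< 4 x y (≤-trans (s≤s (m≤n+m (4 * x) c)) le)

no-multiple : ∀ c x y → c < 3 → suc c + 4 * x ≢ 4 * y
no-multiple c x y c<3 eq = <⇒≱ (s≤s c<3) (+-cancelʳ-≤ (4 * x) 4 (suc c) (begin
  4 + 4 * x        ≡⟨ *-suc 4 x ⟨
  4 * suc x        ≤⟨ *-monoʳ-≤ 4 (quarter c x y (≤-reflexive eq)) ⟩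
  4 * y            ≡⟨ eq ⟨
  suc c + 4 * x    ∎))
  where open ≤-Reasoning

-- The truncated subtractions of `p` are resolved here once for both bounds. 13, 16, 18, 19 are the
-- values at 8 to 11, and four more vertices add seven edges; 8 ≤ n makes the quotient at least 2.
p-cases : (P : ℕ → ℕ → Set) →
                (∀ q → P (8 + q * 4) (13 + q * 7)) → (∀ q → P (9 + q * 4) (16 + q * 7)) →
                (∀ q → P (10 + q * 4) (18 + q * 7)) → (∀ q → P (11 + q * 4) (19 + q * 7)) →
                ∀ n → 8 ≤ n → P n (p n)
p-cases P p₀ p₁ p₂ p₃ n 8≤n with n % 4 | m%n<n n 4 | m≡m%n+[m/n]*n n 4 | /-monoˡ-≤ 4 8≤n
... | 0 | _ | n≡ | 2≤ = case n (n / 4) n≡ 2≤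
  where
  double : ∀ q → 2 * (8 + q * 4) ≡ suc (suc (suc q)) + (13 + q * 7)
  double = solve-∀
  minus : ∀ q → 13 + q * 7 ≡ 2 * (8 + q * 4) ∸ 1 ∸ suc (suc q)
  minus q = sym (≡-trans (cong (λ m → m ∸ 1 ∸ (2 + q)) (double q)) (m+n∸m≡n (2 + q) (13 + q * 7)))
  case : ∀ n q → n ≡ 0 + q * 4 → 2 ≤ q → P n (2 * n ∸ 1 ∸ q)
  case _ (suc (suc q)) refl (s≤s (s≤s z≤n)) = subst (P (8 + q * 4)) (minus q) (p₀ q)
... | 1 | _ | n≡ | 2≤ = case n (n / 4) n≡ 2≤
  where
  double : ∀ q → 2 * (9 + q * 4) ≡ suc (suc q) + (16 + q * 7)
  double = solve-∀
  minus : ∀ q → 16 + q * 7 ≡ 2 * (9 + q * 4) ∸ suc (suc q)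
  minus q = sym (≡-trans (cong (_∸ (2 + q)) (double q)) (m+n∸m≡n (2 + q) (16 + q * 7)))
  case : ∀ n q → n ≡ 1 + q * 4 → 2 ≤ q → P n (2 * n ∸ q)
  case _ (suc (suc q)) refl (s≤s (s≤s z≤n)) = subst (P (9 + q * 4)) (minus q) (p₁ q)
... | 2 | _ | n≡ | 2≤ = case n (n / 4) n≡ 2≤
  where
  double : ∀ q → 2 * (10 + q * 4) ≡ suc (suc q) + (18 + q * 7)
  double = solve-∀
  minus : ∀ q → 18 + q * 7 ≡ 2 * (10 + q * 4) ∸ suc (suc q)
  minus q = sym (≡-trans (cong (_∸ (2 + q)) (double q)) (m+n∸m≡n (2 + q) (18 + q * 7)))
  case : ∀ n q → n ≡ 2 + q * 4 → 2 ≤ q → P n (2 * n ∸ q)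
  case _ (suc (suc q)) refl (s≤s (s≤s z≤n)) = subst (P (10 + q * 4)) (minus q) (p₂ q)
... | 3 | _ | n≡ | 2≤ = case n (n / 4) n≡ 2≤
  where
  double : ∀ q → 2 * (11 + q * 4) ≡ suc (suc (suc q)) + (19 + q * 7)
  double = solve-∀
  minus : ∀ q → 19 + q * 7 ≡ 2 * (11 + q * 4) ∸ 1 ∸ suc (suc q)
  minus q = sym (≡-trans (cong (λ m → m ∸ 1 ∸ (2 + q)) (double q)) (m+n∸m≡n (2 + q) (19 + q * 7)))
  case : ∀ n q → n ≡ 3 + q * 4 → 2 ≤ q → P n (2 * n ∸ 1 ∸ q)
  case _ (suc (suc q)) refl (s≤s (s≤s z≤n)) = subst (P (11 + q * 4)) (minus q) (p₃ q)
... | suc (suc (suc (suc _))) | s≤s (s≤s (s≤s (s≤s ()))) | _ | _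

-- For residues 0 and 3, rounding 7 n ≤ 4 (m + 1) suffices. For 1 and 2 it falls one edge short:
-- there divisibility excludes equality, and the extra 3 yields the missing edge.
sharp-bound : ∀ n → 8 ≤ n → ∀ m → 7 * n ≡ 4 * suc m ⊎ 3 + 7 * n ≤ 4 * suc m → p n ≤ m
sharp-bound = p-cases (λ n s → ∀ m → 7 * n ≡ 4 * suc m ⊎ 3 + 7 * n ≤ 4 * suc m → s ≤ m) r₀ r₁ r₂ r₃
  where
  weaken : ∀ {x y} → x ≡ y ⊎ 3 + x ≤ y → x ≤ y
  weaken (inj₁ x≡y) = ≤-reflexive x≡y
  weaken (inj₂ le)  = ≤-trans (m≤n+m _ 3) le
  r₀ : ∀ q m → 7 * (8 + q * 4) ≡ 4 * suc m ⊎ 3 + 7 * (8 + q * 4) ≤ 4 * suc m → 13 + q * 7 ≤ m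
  r₀ q m good = ≤-pred (*-cancelˡ-≤ 4 (subst (_≤ 4 * suc m) (eq q) (weaken good)))
    where
    eq : ∀ q → 7 * (8 + q * 4) ≡ 4 * (14 + q * 7)
    eq = solve-∀
  r₁ : ∀ q m → 7 * (9 + q * 4) ≡ 4 * suc m ⊎ 3 + 7 * (9 + q * 4) ≤ 4 * suc m → 16 + q * 7 ≤ m
  r₁ q m (inj₁ e)  = contradiction (≡-trans (sym (eq q)) e) (no-multiple 2 (15 + q * 7) (suc m) ≤-refl)
    where
    eq : ∀ q → 7 * (9 + q * 4) ≡ 3 + 4 * (15 + q * 7)
    eq = solve-∀
  r₁ q m (inj₂ le) = ≤-pred (quarter 1 (16 + q * 7) (suc m) (subst (_≤ 4 * suc m) (eq q) le))
    where
    eq : ∀ q → 3 + 7 * (9 + q * 4) ≡ 2 + 4 * (16 + q * 7)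
    eq = solve-∀
  r₂ : ∀ q m → 7 * (10 + q * 4) ≡ 4 * suc m ⊎ 3 + 7 * (10 + q * 4) ≤ 4 * suc m → 18 + q * 7 ≤ m
  r₂ q m (inj₁ e)  = contradiction (≡-trans (sym (eq q)) e) (no-multiple 1 (17 + q * 7) (suc m) (n≤1+n 2))
    where
    eq : ∀ q → 7 * (10 + q * 4) ≡ 2 + 4 * (17 + q * 7)
    eq = solve-∀
  r₂ q m (inj₂ le) = ≤-pred (quarter 0 (18 + q * 7) (suc m) (subst (_≤ 4 * suc m) (eq q) le))
    where
    eq : ∀ q → 3 + 7 * (10 + q * 4) ≡ 1 + 4 * (18 + q * 7)
    eq = solve-∀
  r₃ : ∀ q m → 7 * (11 + q * 4) ≡ 4 * suc m ⊎ 3 + 7 * (11 + q * 4) ≤ 4 * suc m → 19 + q * 7 ≤ m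
  r₃ q m good = ≤-pred (quarter 0 (19 + q * 7) (suc m) (subst (_≤ 4 * suc m) (eq q) (weaken good)))
    where
    eq : ∀ q → 7 * (11 + q * 4) ≡ 1 + 4 * (19 + q * 7)
    eq = solve-∀

-- The four bases have orders 8, 9, 10, 11: a K₄ bridged to K₄, to K₅ minus an edge, three glued K₄,
-- and two glued K₄ with a bridged third.
attained-p : ∀ n → 8 ≤ n → Attained n (p n)
attained-p = p-cases Attained
  (attained-bridges (attained-bridge attained-4)) (attained-bridges (attained-bridge attained-5))
  (attained-bridges (attained-glue (attained-glue attained-4)))
  (attained-bridges (attained-bridge (attained-glue attained-4)))

theorem4 : (n : ℕ) → 8 ≤ n →
    ((G : Graph n) → Connected G → LocallyNonforesty G → p n ≤ size G)
    × Σ (Graph n) (λ G → Connected G × LocallyNonforesty G × size G ≡ p n)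
theorem4 n@(suc _) 8≤n =
  (λ G conn wheels → sharp-bound n 8≤n (size G)
    (subst (λ m → 7 * n ≡ m ⊎ 3 + 7 * n ≤ m) (sym (*-suc 4 (size G))) (good-size G wheels zero conn))) ,
  attained-p n 8≤n
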